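{- The axiomatic system $\mathbf{K}^\circ$ is sound and strongly complete with respect to the class of serial frames ($\mathcal{D}$-frames). That is, with $F$ the class of serial frames: every theorem of $\mathbf{K}^\circ$ is valid on $F$ (soundness), and for every set $\Gamma\cup\{\phi\}$ of $\mathcal{L}(\circ)$-formulas, if $\Gamma\vDash_F\phi$ then $\Gamma\vdash_{\mathbf{K}^\circ}\phi$ (strong completeness).
   Context: Let $\mathbf{P}$ be a set of propositional variables, with $p,q\in\mathbf{P}$ distinct. The language $\mathcal{L}(\circ)$ is given by $\phi::=r\mid\neg\phi\mid(\phi\land\phi)\mid\circ\phi$ with $r\in\mathbf{P}$; other Boolean connectives and $\top$ are the usual abbreviations. A frame is $\langle S,R\rangle$ with $S$ a nonempty set and $R\subseteq S\times S$; it is serial if every $s\in S$ has some $t$ with $sRt$. A model based on a frame is $\mathcal{M}=\langle S,R,V\rangle$ with $V:\mathbf{P}\to\mathcal{P}(S)$. Satisfaction: $\mathcal{M},s\vDash r$ iff $s\in V(r)$; Booleans as usual; $\mathcal{M},s\vDash\circ\phi$ iff ($\mathcal{M},s\vDash\phi$ implies that $\mathcal{M},t\vDash\phi$ for all $t$ with $sRt$). For a class $F$ of frames, $\phi$ is valid on $F$ if $\mathcal{M},s\vDash\phi$ for every model $\mathcal{M}$ based on a frame in $F$ and every $s$ in $\mathcal{M}$; $\Gamma\vDash_F\phi$ means: for every model $\mathcal{M}$ based on a frame in $F$ and every $s$ in $\mathcal{M}$, if $\mathcal{M},s\vDash\gamma$ for all $\gamma\in\Gamma$ then $\mathcal{M},s\vDash\phi$.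 The system $\mathbf{K}^\circ$ has as axioms all propositional tautologies, $\circ\top$, $\neg p\to\circ p$, and $\circ p\land\circ q\to\circ(p\land q)$, and as inference rules uniform substitution, modus ponens, and the rule: from $\phi\to\psi$ infer $\circ\phi\land\phi\to\circ\psi$. A derivation from $\Gamma$ to $\phi$ in the system, written $\Gamma\vdash\phi$ (with the system as subscript), is a finite sequence of $\mathcal{L}(\circ)$-formulas (ending in $\phi$) in which each formula is either an instantiation of an axiom, or an element of $\Gamma$, or the result of applying an inference rule to prior formulas in the sequence. A theorem is a formula $\phi$ for which there is a derivation from $\emptyset$ to $\phi$. -}

module Defs where

open import Data.Bool.Base as Bool using (Bool; true)
open import Data.List.Base using (List; []; _∷_)
open import Data.List.Membership.Propositional using (_∈_)
open import Data.Product.Base using (∃-syntax; _×_)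
open import Level using (0ℓ)
open import Relation.Binary.Core using (Rel)
open import Relation.Binary.PropositionalEquality using (_≡_)
open import Relation.Nullary.Negation using (¬_)
open import Relation.Unary using (Pred; ∅)

infix  9 ~_ ∘_
infixr 7 _∧_
infixr 5 _⇒_
infixl 10 _[_]

data Formula (P : Set) : Set where
  var : P → Formula P
  ~_  : Formula P → Formula P
  _∧_ : Formula P → Formula P → Formula P
  ∘_  : Formula P → Formula P

_⇒_ : {P : Set} → Formula P → Formula P → Formula P
φ ⇒ ψ = ~ (φ ∧ ~ ψ)

-- The language has no primitive constant, so ⊤ abbreviates a tautology in a
-- chosen variable.
⊤ : {P : Set} → P → Formula P
⊤ r = ~ (var r ∧ ~ var r)

_[_] : {P : Set} → Formula P → (P → Formula P) → Formula P
var r   [ σ ] = σ r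
(~ φ)   [ σ ] = ~ (φ [ σ ])
(φ ∧ ψ) [ σ ] = φ [ σ ] ∧ ψ [ σ ]
(∘ φ)   [ σ ] = ∘ (φ [ σ ])

record Frame : Set₁ where
  field
    S        : Set
    nonempty : S
    R        : Rel S 0ℓ

FrameClass : Set₁
FrameClass = Pred Frame 0ℓ

Serial : FrameClass
Serial 𝓕 = ∀ s → ∃[ t ] R s t
  where open Frame 𝓕

record Model (P : Set) : Set₁ where
  field
    frame : Frame
  open Frame frame public
  field
    V : P → Pred S 0ℓ

infix 4 _,_⊨_

_,_⊨_ : {P : Set} (𝓜 : Model P) → Model.S 𝓜 → Formula P → Set
𝓜 , s ⊨ var r   = Model.V 𝓜 r s
𝓜 , s ⊨ ~ φ     = ¬ (𝓜 , s ⊨ φ)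
𝓜 , s ⊨ (φ ∧ ψ) = (𝓜 , s ⊨ φ) × (𝓜 , s ⊨ ψ)
𝓜 , s ⊨ ∘ φ     = 𝓜 , s ⊨ φ → ∀ t → Model.R 𝓜 s t → 𝓜 , t ⊨ φ

ValidOn : {P : Set} → FrameClass → Formula P → Set₁
ValidOn {P} F φ = (𝓜 : Model P) → F (Model.frame 𝓜) → ∀ s → 𝓜 , s ⊨ φ

Consequence : {P : Set} → FrameClass → Pred (Formula P) 0ℓ → Formula P → Set₁
Consequence {P} F Γ φ =
  (𝓜 : Model P) → F (Model.frame 𝓜) →
  ∀ s → (∀ γ → Γ γ → 𝓜 , s ⊨ γ) → 𝓜 , s ⊨ φ

-- Boolean evaluation treating variables and formulas ∘ φ as atoms; v is only
-- consulted on those.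
eval : {P : Set} → (Formula P → Bool) → Formula P → Bool
eval v (var r) = v (var r)
eval v (~ φ)   = Bool.not (eval v φ)
eval v (φ ∧ ψ) = eval v φ Bool.∧ eval v ψ
eval v (∘ φ)   = v (∘ φ)

Tautology : {P : Set} → Formula P → Set
Tautology φ = ∀ v → eval v φ ≡ true

module K∘ {P : Set} (p q : P) where

  data Axiom : Pred (Formula P) 0ℓ where
    taut : ∀ {φ} → Tautology φ → Axiom φ
    ∘⊤   : Axiom (∘ ⊤ p)
    ¬p⇒∘ : Axiom (~ var p ⇒ ∘ var p)
    ∘∧   : Axiom (∘ var p ∧ ∘ var q ⇒ ∘ (var p ∧ var q))

  -- ψ may follow the formulas in prior. The rules apply to all prior formulas,
  -- including members of Γ and their consequences.
  data Step (Γ : Pred (Formula P) 0ℓ) (prior : List (Formula P)) :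
            Pred (Formula P) 0ℓ where
    axiom        : ∀ {α} → Axiom α → ∀ σ → Step Γ prior (α [ σ ])
    premise      : ∀ {γ} → Γ γ → Step Γ prior γ
    substitution : ∀ {φ} → φ ∈ prior → ∀ σ → Step Γ prior (φ [ σ ])
    modusPonens  : ∀ {φ ψ} → φ ∈ prior → φ ⇒ ψ ∈ prior → Step Γ prior ψ
    ∘-rule       : ∀ {φ ψ} → φ ⇒ ψ ∈ prior → Step Γ prior (∘ φ ∧ φ ⇒ ∘ ψ)

  -- Sequences are stored latest formula first.
  data Derivation (Γ : Pred (Formula P) 0ℓ) : Pred (List (Formula P)) 0ℓ where
    []  : Derivation Γ []
    _∷_ : ∀ {φ prior} → Step Γ prior φ → Derivation Γ prior →
          Derivation Γ (φ ∷ prior)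

  infix 4 _⊢_

  _⊢_ : Pred (Formula P) 0ℓ → Formula P → Set
  Γ ⊢ φ = ∃[ prior ] Derivation Γ (φ ∷ prior)

  Theorem : Formula P → Set
  Theorem φ = ∅ ⊢ φ

Sound : {P : Set} → P → P → FrameClass → Set₁
Sound p q F = ∀ φ → K∘.Theorem p q φ → ValidOn F φ

StronglyComplete : {P : Set} → P → P → FrameClass → Set₁
StronglyComplete p q F = ∀ Γ φ → Consequence F Γ φ → K∘._⊢_ p q Γ φ

-- Soundness is an induction over derivations.  For completeness, suppose
-- Γ ⊬ φ.  The consequences of Γ are closed under uniform substitution, so all
-- variables may be mapped to those occurring in φ (and p): it is enough to work
-- over a finite set of variables, where the formulas are countable and
-- Lindenbaum's lemma needs excluded middle but no choice.  In the canonical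
-- model w sees u when u contains D w = { ψ | ψ ∈ w and ∘ ψ ∈ w }.  As D w ⊆ w,
-- this relation is reflexive, hence serial.  D w is a theory, so if ∘ ψ ∉ w,
-- Lindenbaum's lemma separates ψ from D w and yields a successor of w omitting
-- ψ, while ψ ∈ w by ~ ψ ⇒ ∘ ψ.

module Submission where

open import Defs
open import Axiom.ExcludedMiddle using (ExcludedMiddle)
open import Data.Bool.Base as Bool using (Bool; true; false)
open import Data.Bool.Properties using (¬-not; not-¬)
open import Data.Fin.Base using (Fin; zero)
open import Data.List.Base
  using (List; []; _∷_; _++_; map; foldr; length; lookup; cartesianProductWith)
open import Data.List.Membership.Propositional using (_∈_)
open import Data.List.Membership.Propositional.Properties
  using (∈-++⁺ˡ; ∈-++⁺ʳ; ∈-map⁺; ∈-allFin; ∈-cartesianProductWith⁺)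
open import Data.List.Relation.Binary.Subset.Propositional using (_⊆_)
open import Data.List.Relation.Binary.Subset.Propositional.Properties
  using (xs⊆xs++ys)
open import Data.List.Relation.Unary.All as All using (All; []; _∷_)
open import Data.List.Relation.Unary.Any using (here; there; index)
open import Data.List.Relation.Unary.Any.Properties using (lookup-index)
open import Data.Nat.Base using (ℕ; zero; suc; _≤′_; ≤′-reflexive; ≤′-step; _⊔_)
open import Data.Nat.Properties using (≤⇒≤′; m≤m⊔n; m≤n⊔m)
open import Data.Product.Base using (Σ-syntax; ∃-syntax; _×_; _,_; proj₁; proj₂)
open import Data.Sum.Base using (_⊎_; inj₁; inj₂; [_,_]′)
open import Function.Base using (id; _∘′_)
open import Function.Bundles using (_⇔_; mk⇔; Equivalence)
open import Level using (0ℓ)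
open import Relation.Binary.PropositionalEquality
  using (_≡_; _≢_; refl; sym; trans; cong; cong₂; subst)
open import Relation.Nullary.Decidable using (yes; no; does; dec-true; dec-false; decidable-stable)
open import Relation.Nullary.Negation using (¬_; contradiction)
open import Relation.Unary using (Pred; ∅)

open Equivalence using (to; from)

private variable
  A B P : Set
  φ ψ χ : Formula A

-- Propositional theories

⇒-true : ∀ a b → a ≡ true → Bool.not (a Bool.∧ Bool.not b) ≡ true → b ≡ true
⇒-true true true _ _ = refl

-- A record, so that φ can be inferred from a proof that it is a tautology.
record Taut (φ : Formula A) : Set where
  field holds : Tautology φ

open Taut

⇒-refl : Taut (φ ⇒ φ)
⇒-refl {φ = φ} .holds v with eval v φ
... | true  = refl
... | false = refl

⇒-trans : Taut ((φ ⇒ ψ) ⇒ (ψ ⇒ χ) ⇒ (φ ⇒ χ))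
⇒-trans {φ = φ} {ψ = ψ} {χ = χ} .holds v with eval v φ | eval v ψ | eval v χ
... | true  | true  | true  = refl
... | true  | true  | false = refl
... | true  | false | _     = refl
... | false | true  | true  = refl
... | false | true  | false = refl
... | false | false | _     = refl

⇒-const : Taut (φ ⇒ (ψ ⇒ φ))
⇒-const {φ = φ} {ψ = ψ} .holds v with eval v φ | eval v ψ
... | true  | true  = refl
... | true  | false = refl
... | false | _     = refl

⇒-distrib : Taut ((φ ⇒ ψ) ⇒ (φ ⇒ (ψ ⇒ χ)) ⇒ (φ ⇒ χ))
⇒-distrib {φ = φ} {ψ = ψ} {χ = χ} .holds v with eval v φ | eval v ψ | eval v χ
... | true  | true  | true  = refl
... | true  | true  | false = refl
... | true  | false | _     = refl
... | false | _     | _     = refl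

∧-intro : Taut (φ ⇒ ψ ⇒ φ ∧ ψ)
∧-intro {φ = φ} {ψ = ψ} .holds v with eval v φ | eval v ψ
... | true  | true  = refl
... | true  | false = refl
... | false | _     = refl

∧-elimˡ : Taut (φ ∧ ψ ⇒ φ)
∧-elimˡ {φ = φ} {ψ = ψ} .holds v with eval v φ | eval v ψ
... | true  | true  = refl
... | true  | false = refl
... | false | _     = refl

∧-elimʳ : Taut (φ ∧ ψ ⇒ ψ)
∧-elimʳ {φ = φ} {ψ = ψ} .holds v with eval v φ | eval v ψ
... | true  | true  = refl
... | true  | false = refl
... | false | _     = refl

∧-modusPonens : Taut (φ ∧ (φ ⇒ ψ) ⇒ ψ)
∧-modusPonens {φ = φ} {ψ = ψ} .holds v with eval v φ | eval v ψ
... | true  | true  = refl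
... | true  | false = refl
... | false | _     = refl

cases-~ : Taut (~ (ψ ∧ φ) ⇒ ~ (~ ψ ∧ φ) ⇒ ~ φ)
cases-~ {ψ = ψ} {φ = φ} .holds v with eval v ψ | eval v φ
... | true  | true  = refl
... | true  | false = refl
... | false | true  = refl
... | false | false = refl

⇒-contradiction : Taut ((φ ⇒ ψ) ⇒ (φ ⇒ ~ ψ) ⇒ ~ φ)
⇒-contradiction {φ = φ} {ψ = ψ} .holds v with eval v φ | eval v ψ
... | true  | true  = refl
... | true  | false = refl
... | false | _     = refl

~~-elim : Taut (~ ~ φ ⇒ φ)
~~-elim {φ = φ} .holds v with eval v φ
... | true  = refl
... | false = refl

-- Only propositional closure is demanded, so that worlds and the sets `D w` qualify even where
-- substitution or the `∘`-rule leads outside them.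
record Theory (T : Pred (Formula A) 0ℓ) : Set where
  field
    tautology   : Taut φ → T φ
    modusPonens : T φ → T (φ ⇒ ψ) → T ψ

  consequence : Taut (φ ⇒ ψ) → T φ → T ψ
  consequence t x = modusPonens x (tautology t)

  consequence₂ : Taut (φ ⇒ ψ ⇒ χ) → T φ → T ψ → T χ
  consequence₂ t x y = modusPonens y (consequence t x)

-- Lindenbaum's lemma

-- Since `eval v` reads `v` only at variables and formulas `∘ φ`, this says that `v` commutes with
-- `~_` and `_∧_`, as the characteristic function of a complete consistent theory does.
IsHomomorphism : (Formula A → Bool) → Set
IsHomomorphism v = ∀ φ → eval v φ ≡ v φ

homomorphism⇒theory : (v : Formula A → Bool) → IsHomomorphism v →
                      Theory (λ φ → v φ ≡ true)
homomorphism⇒theory v hom = record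
  { tautology   = λ {φ} t → trans (sym (hom φ)) (t .holds v)
  ; modusPonens = λ {φ} {ψ} x y →
      trans (sym (hom ψ))
        (⇒-true (eval v φ) (eval v ψ) (trans (hom φ) x) (trans (hom (φ ⇒ ψ)) y))
  }

module Indicator (em : ExcludedMiddle 0ℓ) {A : Set} (T : Pred A 0ℓ) where

  indicator : A → Bool
  indicator x = does (em {T x})

  indicator⁺ : ∀ {x} → T x → indicator x ≡ true
  indicator⁺ = dec-true em

  indicator⁻ : ∀ {x} → indicator x ≡ true → T x
  indicator⁻ {x} e with em {T x}
  ... | yes t = t

  indicator-false : ∀ {x} → ¬ T x → indicator x ≡ false
  indicator-false = dec-false em

-- Serves twice: for the limit in Lindenbaum's lemma and, in the soundness proof, for the formulas
-- satisfied at a state.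
module Complete (em : ExcludedMiddle 0ℓ) (T : Pred (Formula A) 0ℓ)
  (T-~ : ∀ φ → T (~ φ) ⇔ (¬ T φ)) (T-∧ : ∀ φ ψ → T (φ ∧ ψ) ⇔ (T φ × T ψ)) where

  open Indicator em T

  indicator-homomorphism : IsHomomorphism indicator
  indicator-homomorphism (var r) = refl
  indicator-homomorphism (∘ φ)   = refl
  indicator-homomorphism (~ φ)
    rewrite indicator-homomorphism φ with em {T φ}
  ... | yes x = sym (indicator-false λ y → to (T-~ φ) y x)
  ... | no ¬x = sym (indicator⁺ (from (T-~ φ) ¬x))
  indicator-homomorphism (φ ∧ ψ)
    rewrite indicator-homomorphism φ | indicator-homomorphism ψ
    with em {T φ} | em {T ψ}
  ... | yes x | yes y = sym (indicator⁺ (from (T-∧ φ ψ) (x , y)))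
  ... | yes x | no ¬y = sym (indicator-false (¬y ∘′ proj₂ ∘′ to (T-∧ φ ψ)))
  ... | no ¬x | _     = sym (indicator-false (¬x ∘′ proj₁ ∘′ to (T-∧ φ ψ)))

-- Finite batches, rather than a sequence of single elements, spare a coding of pairs of formulas.
record Enumeration (A : Set) : Set where
  field
    batch   : ℕ → List A
    covered : ∀ x → ∃[ n ] x ∈ batch n

module Lindenbaum (em : ExcludedMiddle 0ℓ) (enumeration : Enumeration (Formula A))
  {T : Pred (Formula A) 0ℓ} (theory : Theory T) {φ : Formula A} (φ∉T : ¬ T φ) where

  open Enumeration enumeration
  open Theory theory

  Consistent : Pred (Formula A) 0ℓ
  Consistent α = ¬ T (~ α)

  Decides : Formula A → Pred (Formula A) 0ℓ
  Decides α ψ = T (α ⇒ ψ) ⊎ T (α ⇒ ~ ψ)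

  T-trans : ∀ {α β γ} → T (α ⇒ β) → T (β ⇒ γ) → T (α ⇒ γ)
  T-trans = consequence₂ ⇒-trans

  Decides-mono : ∀ {α β ψ} → T (β ⇒ α) → Decides α ψ → Decides β ψ
  Decides-mono β⇒α (inj₁ x) = inj₁ (T-trans β⇒α x)
  Decides-mono β⇒α (inj₂ x) = inj₂ (T-trans β⇒α x)

  -- The formula `α` carries all earlier choices as one conjunction, in place of a finite set of
  -- formulas.
  step : Formula A → Formula A → Formula A
  step ψ α with em {T (~ (ψ ∧ α))}
  ... | yes _ = ~ ψ ∧ α
  ... | no _  = ψ ∧ α

  -- If `T` refuted both `ψ ∧ α` and `~ ψ ∧ α`, it would refute `α`.
  step-consistent : ∀ ψ {α} → Consistent α → Consistent (step ψ α)
  step-consistent ψ {α} c with em {T (~ (ψ ∧ α))}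
  ... | yes x = c ∘′ consequence₂ cases-~ x
  ... | no ¬x = ¬x

  step-⇒ : ∀ ψ α → T (step ψ α ⇒ α)
  step-⇒ ψ α with em {T (~ (ψ ∧ α))}
  ... | yes _ = tautology ∧-elimʳ
  ... | no _  = tautology ∧-elimʳ

  step-decides : ∀ ψ α → Decides (step ψ α) ψ
  step-decides ψ α with em {T (~ (ψ ∧ α))}
  ... | yes _ = inj₂ (tautology ∧-elimˡ)
  ... | no _  = inj₁ (tautology ∧-elimˡ)

  extend : Formula A → List (Formula A) → Formula A
  extend = foldr step

  extend-consistent : ∀ {α} ψs → Consistent α → Consistent (extend α ψs)
  extend-consistent []       c = c
  extend-consistent (ψ ∷ ψs) c = step-consistent ψ (extend-consistent ψs c)

  extend-⇒ : ∀ α ψs → T (extend α ψs ⇒ α)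
  extend-⇒ α []       = tautology ⇒-refl
  extend-⇒ α (ψ ∷ ψs) = T-trans (step-⇒ ψ (extend α ψs)) (extend-⇒ α ψs)

  extend-decides : ∀ {ψ} α {ψs} → ψ ∈ ψs → Decides (extend α ψs) ψ
  extend-decides α {ψ ∷ ψs} (here refl) = step-decides ψ (extend α ψs)
  extend-decides α {ψ ∷ ψs} (there i)   =
    Decides-mono (step-⇒ ψ (extend α ψs)) (extend-decides α i)

  stage : ℕ → Formula A
  stage zero    = ~ φ
  stage (suc n) = extend (stage n) (batch n)

  stage-consistent : ∀ n → Consistent (stage n)
  stage-consistent zero    = φ∉T ∘′ consequence ~~-elim
  stage-consistent (suc n) = extend-consistent (batch n) (stage-consistent n)

  stage-⇒ : ∀ {m n} → m ≤′ n → T (stage n ⇒ stage m)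
  stage-⇒ (≤′-reflexive refl) = tautology ⇒-refl
  stage-⇒ {n = suc n} (≤′-step m≤n) = T-trans (extend-⇒ (stage n) (batch n)) (stage-⇒ m≤n)

  Limit : Pred (Formula A) 0ℓ
  Limit ψ = ∃[ n ] T (stage n ⇒ ψ)

  -- Later stages imply earlier ones in `T`, so both memberships can be moved to the larger of the
  -- two stages.
  Limit₂ : (∀ n → T (stage n ⇒ ψ) → T (stage n ⇒ χ) → B) → Limit ψ → Limit χ → B
  Limit₂ f (m , x) (n , y) =
    f (m ⊔ n) (T-trans (stage-⇒ (≤⇒≤′ (m≤m⊔n m n))) x)
              (T-trans (stage-⇒ (≤⇒≤′ (m≤n⊔m m n))) y)

  Limit-⊇ : T ψ → Limit ψ
  Limit-⊇ x = 0 , consequence ⇒-const x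

  Limit-theory : Theory Limit
  Limit-theory = record
    { tautology   = λ t → Limit-⊇ (tautology t)
    ; modusPonens = Limit₂ (λ n x y → n , consequence₂ ⇒-distrib x y)
    }

  Limit-complete : ∀ ψ → Limit ψ ⊎ Limit (~ ψ)
  Limit-complete ψ with covered ψ
  ... | n , i with extend-decides (stage n) i
  -- `batch n` is treated on the way from `stage n` to `stage (suc n)`.
  ...   | inj₁ x = inj₁ (suc n , x)
  ...   | inj₂ x = inj₂ (suc n , x)

  Limit-consistent : Limit ψ → ¬ Limit (~ ψ)
  Limit-consistent =
    Limit₂ (λ n x y → stage-consistent n (consequence₂ ⇒-contradiction x y))

  Limit-~ : ∀ ψ → Limit (~ ψ) ⇔ (¬ Limit ψ)
  Limit-~ ψ = mk⇔ (λ y x → Limit-consistent x y) λ ¬x →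
    [ (λ x → contradiction x ¬x) , id ]′ (Limit-complete ψ)

  Limit-∧ : ∀ ψ χ → Limit (ψ ∧ χ) ⇔ (Limit ψ × Limit χ)
  Limit-∧ ψ χ = mk⇔
    (λ z → consequence-Limit ∧-elimˡ z , consequence-Limit ∧-elimʳ z)
    (λ { (x , y) → consequence₂-Limit ∧-intro x y })
    where
    open Theory Limit-theory
      renaming (consequence to consequence-Limit; consequence₂ to consequence₂-Limit)

  lindenbaum : Σ[ v ∈ (Formula A → Bool) ]
    IsHomomorphism v × (∀ {ψ} → T ψ → v ψ ≡ true) × v φ ≡ false
  lindenbaum =
    indicator
    , Complete.indicator-homomorphism em Limit Limit-~ Limit-∧
    , indicator⁺ ∘′ Limit-⊇
    -- `stage 0` is `~ φ`, which puts `~ φ` into the limit.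
    , indicator-false (λ x → Limit-consistent x (0 , tautology ⇒-refl))
    where open Indicator em Limit

-- Countability of formulas over finitely many variables

module _ {xs : List A} (all∈ : ∀ x → x ∈ xs) where

  -- Formulas of nesting depth at most `n`. Keeping the earlier ones lets conjuncts of different
  -- depths meet in a common list.
  formulas : ℕ → List (Formula A)
  formulas zero    = map var xs
  formulas (suc n) =
    formulas n ++ map ~_ (formulas n) ++ map ∘_ (formulas n) ++
    cartesianProductWith _∧_ (formulas n) (formulas n)

  formulas-mono : ∀ {m n} → m ≤′ n → formulas m ⊆ formulas n
  formulas-mono (≤′-reflexive refl) = id
  formulas-mono (≤′-step m≤n)       = ∈-++⁺ˡ ∘′ formulas-mono m≤n

  ∈-formulas : ∀ φ → ∃[ n ] φ ∈ formulas n
  ∈-formulas (var x) = 0 , ∈-map⁺ var (all∈ x)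
  ∈-formulas (~ φ) with ∈-formulas φ
  ... | n , i = suc n , ∈-++⁺ʳ (formulas n) (∈-++⁺ˡ (∈-map⁺ ~_ i))
  ∈-formulas (∘ φ) with ∈-formulas φ
  ... | n , i = suc n ,
    ∈-++⁺ʳ (formulas n) (∈-++⁺ʳ (map ~_ (formulas n)) (∈-++⁺ˡ (∈-map⁺ ∘_ i)))
  ∈-formulas (φ ∧ ψ) with ∈-formulas φ | ∈-formulas ψ
  ... | m , i | n , j = suc k ,
    ∈-++⁺ʳ (formulas k) (∈-++⁺ʳ (map ~_ (formulas k)) (∈-++⁺ʳ (map ∘_ (formulas k))
      (∈-cartesianProductWith⁺ _∧_
        (formulas-mono (≤⇒≤′ (m≤m⊔n m n)) i) (formulas-mono (≤⇒≤′ (m≤n⊔m m n)) j))))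
    where k = m ⊔ n

  formulaEnumeration : Enumeration (Formula A)
  formulaEnumeration = record { batch = formulas ; covered = ∈-formulas }

-- The canonical model

rename : (A → B) → Formula A → Formula B
rename f (var r) = var (f r)
rename f (~ φ)   = ~ rename f φ
rename f (φ ∧ ψ) = rename f φ ∧ rename f ψ
rename f (∘ φ)   = ∘ rename f φ

-- Schemes take the place of axioms with substitution: for the set `Γ ⊢ rename f φ` below, `f` may
-- identify variables, and the set need not then be closed under substitution.
record Logic (L : Pred (Formula A) 0ℓ) : Set where
  field
    theory : Theory L
    ∘⊤     : L (∘ (~ (φ ∧ ~ φ)))
    ~⇒∘    : L (~ φ ⇒ ∘ φ)
    ∘∧     : L (∘ φ ∧ ∘ ψ ⇒ ∘ (φ ∧ ψ))
    ∘-mono : L (φ ⇒ ψ) → L (∘ φ ∧ φ ⇒ ∘ ψ)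

module Canonical (em : ExcludedMiddle 0ℓ) (enumeration : Enumeration (Formula A))
  {L : Pred (Formula A) 0ℓ} (logic : Logic L) where

  open Logic logic

  -- Worlds are Bool-valued so that they form a Set; predicates on formulas
  -- would live in Set₁.
  record World : Set where
    field
      valuation    : Formula A → Bool
      homomorphism : IsHomomorphism valuation

    infix 4 ∋_
    ∋_ : Pred (Formula A) 0ℓ
    ∋ φ = valuation φ ≡ true

    field
      ∋-L : L φ → ∋ φ

    open Theory (homomorphism⇒theory valuation homomorphism) public

    ∋-∧ : ∋ φ → ∋ ψ → ∋ φ ∧ ψ
    ∋-∧ = consequence₂ ∧-intro

    ∋-∘-mono : L (φ ⇒ ψ) → ∋ φ → ∋ ∘ φ → ∋ ∘ ψ
    ∋-∘-mono x φ∈ ∘φ∈ = modusPonens (∋-∧ ∘φ∈ φ∈) (∋-L (∘-mono x))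

    D : Pred (Formula A) 0ℓ
    D φ = ∋ φ × ∋ ∘ φ

    -- A member `φ` of `L` is implied by the tautology `φ ⇒ φ`, so the `∘`-rule takes `∘ (φ ⇒ φ)` to
    -- `∘ φ`.
    D-L : L φ → D φ
    D-L {φ = φ} x = ∋-L x , ∋-∘-mono (Theory.consequence theory ⇒-const x)
      (tautology (⇒-refl {φ = φ})) (∋-L ∘⊤)

    -- The operator `∘` is not monotone: the `∘`-rule passes from `∘ φ` to `∘ ψ` only where `φ`
    -- holds. This is why `D` asks for `φ` besides `∘ φ`.
    D-theory : Theory D
    D-theory = record
      { tautology   = λ t → D-L (Theory.tautology theory t)
      ; modusPonens = λ { (φ∈ , ∘φ∈) (i∈ , ∘i∈) →
          modusPonens φ∈ i∈ ,
          ∋-∘-mono (Theory.tautology theory ∧-modusPonens)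
            (∋-∧ φ∈ i∈) (modusPonens (∋-∧ ∘φ∈ ∘i∈) (∋-L ∘∧)) }
      }

    valuation-~ : ∀ φ → valuation (~ φ) ≡ Bool.not (valuation φ)
    valuation-~ φ = trans (sym (homomorphism (~ φ))) (cong Bool.not (homomorphism φ))

    ∋-~ : ∀ φ → (∋ ~ φ) ⇔ (¬ (∋ φ))
    ∋-~ φ = mk⇔
      (λ x y → contradiction (trans (sym x) (trans (valuation-~ φ) (cong Bool.not y))) λ ())
      (λ ¬y → trans (valuation-~ φ) (cong Bool.not (¬-not ¬y)))

    ∋-¬∘ : ¬ (∋ ∘ φ) → ∋ φ
    ∋-¬∘ {φ = φ} ¬∘φ = decidable-stable em λ ¬φ →
      ¬∘φ (modusPonens (from (∋-~ φ) ¬φ) (∋-L ~⇒∘))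

  open World renaming (∋_ to _∋_)

  -- Applied to `L` it yields the world that refutes a non-theorem, and applied to `D w` a successor
  -- of `w`.
  separate : {T : Pred (Formula A) 0ℓ} → Theory T → (∀ {ψ} → L ψ → T ψ) → ¬ T φ →
             Σ[ w ∈ World ] (∀ ψ → T ψ → w ∋ ψ) × ¬ (w ∋ φ)
  separate theory-T L⊆T φ∉T with Lindenbaum.lindenbaum em enumeration theory-T φ∉T
  ... | v , hom , T⊆v , φ∉v =
    record { valuation = v ; homomorphism = hom ; ∋-L = T⊆v ∘′ L⊆T }
    , (λ _ → T⊆v) , not-¬ φ∉v

  -- Worlds speak of `A`, the model of `P`: a variable `r` is read as `f r`. The world `w₀`
  -- witnesses nonemptiness.
  module _ (w₀ : World) (f : P → A) where

    canonical : Model P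
    canonical = record
      { frame = record
          { S        = World
          ; nonempty = w₀
          ; R        = λ w u → ∀ ψ → D w ψ → u ∋ ψ
          }
      ; V = λ r w → w ∋ var (f r)
      }

    canonical-serial : Serial (Model.frame canonical)
    canonical-serial w = w , λ _ → proj₁

    truth : ∀ φ w → (canonical , w ⊨ φ) ⇔ (w ∋ rename f φ)
    truth (var r) w = mk⇔ id id
    truth (~ φ) w = mk⇔
      (λ h → from (∋-~ w (rename f φ)) (h ∘′ from (truth φ w)))
      (λ x h → to (∋-~ w (rename f φ)) x (to (truth φ w) h))
    truth (φ ∧ ψ) w = mk⇔
      (λ { (x , y) → ∋-∧ w (to (truth φ w) x) (to (truth ψ w) y) })
      (λ z → from (truth φ w) (consequence w ∧-elimˡ z)
           , from (truth ψ w) (consequence w ∧-elimʳ z))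
    truth (∘ φ) w = mk⇔
      (λ h → decidable-stable em λ ∘φ∉w →
        -- Membership in `D w` includes `∘ φ`, so `φ` (renamed) is outside `D w` and can be
        -- separated from it.
        let u , wRu , φ∉u = separate (D-theory w) (D-L w) (∘φ∉w ∘′ proj₂)
        in φ∉u (to (truth φ u) (h (from (truth φ w) (∋-¬∘ w ∘φ∉w)) u wRu)))
      (λ ∘φ∈w x u wRu → from (truth φ u) (wRu (rename f φ) (to (truth φ w) x , ∘φ∈w)))

-- Derivations

-- The round trip is a uniform substitution, and so preserves derivability from `Γ`.
rename-∘ : (f : A → B) (g : B → A) → ∀ φ →
           rename g (rename f φ) ≡ φ [ (λ r → var (g (f r))) ]
rename-∘ f g (var r) = refl
rename-∘ f g (~ φ)   = cong ~_ (rename-∘ f g φ)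
rename-∘ f g (φ ∧ ψ) = cong₂ _∧_ (rename-∘ f g φ) (rename-∘ f g ψ)
rename-∘ f g (∘ φ)   = cong ∘_ (rename-∘ f g φ)

eval-rename : ∀ (f : A → B) v φ → eval v (rename f φ) ≡ eval (v ∘′ rename f) φ
eval-rename f v (var r) = refl
eval-rename f v (~ φ)   = cong Bool.not (eval-rename f v φ)
eval-rename f v (φ ∧ ψ) = cong₂ Bool._∧_ (eval-rename f v φ) (eval-rename f v ψ)
eval-rename f v (∘ φ)   = refl

vars : Formula A → List A
vars (var r) = r ∷ []
vars (~ φ)   = vars φ
vars (φ ∧ ψ) = vars φ ++ vars ψ
vars (∘ φ)   = vars φ

[]-fixed : ∀ (φ : Formula A) {σ} → (∀ {r} → r ∈ vars φ → σ r ≡ var r) → φ [ σ ] ≡ φ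
[]-fixed (var r) h = h (here refl)
[]-fixed (~ φ)   h = cong ~_ ([]-fixed φ h)
[]-fixed (φ ∧ ψ) h =
  cong₂ _∧_ ([]-fixed φ (h ∘′ ∈-++⁺ˡ)) ([]-fixed ψ (h ∘′ ∈-++⁺ʳ (vars φ)))
[]-fixed (∘ φ)   h = cong ∘_ ([]-fixed φ h)

module Derivations (p q : P) (Γ : Pred (Formula P) 0ℓ) where

  open K∘ p q

  Step-mono : ∀ {xs ys} → xs ⊆ ys → Step Γ xs φ → Step Γ ys φ
  Step-mono s (axiom a σ)        = axiom a σ
  Step-mono s (premise γ)        = premise γ
  Step-mono s (substitution i σ) = substitution (s i) σ
  Step-mono s (modusPonens i j)  = modusPonens (s i) (s j)
  Step-mono s (∘-rule i)         = ∘-rule (s i)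

  Derivation-++ : ∀ {xs ys} → Derivation Γ xs → Derivation Γ ys → Derivation Γ (xs ++ ys)
  Derivation-++ []      e = e
  Derivation-++ (x ∷ d) e = Step-mono (xs⊆xs++ys _ _) x ∷ Derivation-++ d e

  ⊢-substitution : ∀ σ → Γ ⊢ φ → Γ ⊢ φ [ σ ]
  ⊢-substitution σ (_ , d) = _ , substitution (here refl) σ ∷ d

  ⊢-modusPonens : Γ ⊢ φ → Γ ⊢ φ ⇒ ψ → Γ ⊢ ψ
  ⊢-modusPonens {φ} (xs , d) (ys , e) = _ ,
    modusPonens (here refl) (∈-++⁺ʳ (φ ∷ xs) (here refl)) ∷ Derivation-++ d e

  ⊢-∘-rule : Γ ⊢ φ ⇒ ψ → Γ ⊢ ∘ φ ∧ φ ⇒ ∘ ψ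
  ⊢-∘-rule (_ , d) = _ , ∘-rule (here refl) ∷ d

  ⊢-axiom : Axiom φ → ∀ σ → Γ ⊢ φ [ σ ]
  ⊢-axiom a σ = [] , axiom a σ ∷ []

  ⊢-tautology : Tautology φ → Γ ⊢ φ
  ⊢-tautology {φ} t = subst (Γ ⊢_) ([]-fixed φ (λ _ → refl)) (⊢-axiom (taut {φ} t) var)

  -- As `p` and `q` differ, one substitution can send them to `φ` and `ψ` independently.
  ⊢-∘∧ : ExcludedMiddle 0ℓ → p ≢ q → ∀ φ ψ → Γ ⊢ ∘ φ ∧ ∘ ψ ⇒ ∘ (φ ∧ ψ)
  ⊢-∘∧ em p≢q φ ψ =
    subst (Γ ⊢_) (cong₂ (λ φ ψ → ∘ φ ∧ ∘ ψ ⇒ ∘ (φ ∧ ψ)) σp σq) (⊢-axiom ∘∧ σ)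
    where
    σ : P → Formula P
    σ r with em {r ≡ p}
    ... | yes _ = φ
    ... | no _  = ψ

    σp : σ p ≡ φ
    σp with em {p ≡ p}
    ... | yes _   = refl
    ... | no p≢p = contradiction refl p≢p

    σq : σ q ≡ ψ
    σq with em {q ≡ p}
    ... | yes q≡p = contradiction (sym q≡p) p≢q
    ... | no _    = refl

  -- All rules apply to consequences of `Γ`, so these form a logic themselves; every world of its
  -- canonical model then contains them.
  ⊢-logic : ExcludedMiddle 0ℓ → p ≢ q → (f : A → P) → Logic (λ φ → Γ ⊢ rename f φ)
  ⊢-logic em p≢q f = record
    { theory = record
        { tautology   = λ {φ} t →
            ⊢-tautology (λ v → trans (eval-rename f v φ) (t .holds (v ∘′ rename f)))
        ; modusPonens = ⊢-modusPonens
        }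
    ; ∘⊤     = λ {φ} → ⊢-axiom ∘⊤ (λ _ → rename f φ)
    ; ~⇒∘    = λ {φ} → ⊢-axiom ¬p⇒∘ (λ _ → rename f φ)
    ; ∘∧     = ⊢-∘∧ em p≢q _ _
    ; ∘-mono = ⊢-∘-rule
    }

module _ (em : ExcludedMiddle 0ℓ) (p : P) (φ : Formula P) where

  varIndex : P → Fin (length (p ∷ vars φ))
  varIndex r with em {r ∈ vars φ}
  ... | yes i = index (there {x = p} i)
  -- Variables foreign to `φ` share the index of `p`.
  ... | no _  = zero

  lookup-varIndex : ∀ {r} → r ∈ vars φ → lookup (p ∷ vars φ) (varIndex r) ≡ r
  lookup-varIndex {r} i with em {r ∈ vars φ}
  ... | yes j = sym (lookup-index j)
  ... | no ¬i = contradiction i ¬i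

stronglyComplete : ExcludedMiddle 0ℓ → (p q : P) → p ≢ q → StronglyComplete p q Serial
stronglyComplete {P} em p q p≢q Γ φ Γ⊨φ = decidable-stable em λ Γ⊬φ →
  let
    w₀ , _ , φ∉w₀ = separate (Logic.theory logic) id
      -- The round trip through the finite variable set fixes the variables of `φ`, hence `φ`
      -- itself.
      (Γ⊬φ ∘′ subst (Γ ⊢_) (trans (rename-∘ code decode φ)
        ([]-fixed φ (λ i → cong var (lookup-varIndex em p φ i)))))
  in φ∉w₀ (to (truth w₀ code φ w₀)
       (Γ⊨φ (canonical w₀ code) (canonical-serial w₀ code) w₀
         -- A premise may have variables outside `φ`. Its round trip is a substitution instance,
         -- still derivable from `Γ`, so its renaming lies in `w₀`.
         (λ γ γ∈Γ → from (truth w₀ code γ w₀) (World.∋-L w₀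
           (subst (Γ ⊢_) (sym (rename-∘ code decode γ))
             (⊢-substitution _ ([] , K∘.premise γ∈Γ ∷ [])))))))
  where
  open K∘ p q using (_⊢_; []; _∷_)
  open Derivations p q Γ
  code = varIndex em p φ
  decode = lookup (p ∷ vars φ)
  logic = ⊢-logic em p≢q decode
  open Canonical em (formulaEnumeration (∈-allFin {length (p ∷ vars φ)})) logic

-- Soundness

module Soundness (em : ExcludedMiddle 0ℓ) where

  ⊨-⇒ : ∀ (𝓜 : Model P) {s} φ ψ → 𝓜 , s ⊨ (φ ⇒ ψ) → 𝓜 , s ⊨ φ → 𝓜 , s ⊨ ψ
  ⊨-⇒ 𝓜 φ ψ h x = decidable-stable em λ ¬y → h (x , ¬y)

  -- The characteristic function of satisfaction at `s` is a homomorphism, so a tautology evaluates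
  -- to `true` under it.
  ⊨-tautology : ∀ (𝓜 : Model P) s → Tautology φ → 𝓜 , s ⊨ φ
  ⊨-tautology {φ = φ} 𝓜 s t =
    indicator⁻ {φ} (trans (sym (indicator-homomorphism φ)) (t indicator))
    where
    open Indicator em (𝓜 , s ⊨_)
    open Complete em (𝓜 , s ⊨_) (λ _ → mk⇔ id id) (λ _ _ → mk⇔ id id)

  substituted : Model P → (P → Formula P) → Model P
  substituted 𝓜 σ = record { frame = Model.frame 𝓜 ; V = λ r s → 𝓜 , s ⊨ σ r }

  -- Only the valuation changes, so the substituted model stays in the same frame class.
  ⊨-[] : ∀ (𝓜 : Model P) σ φ s → (substituted 𝓜 σ , s ⊨ φ) ⇔ (𝓜 , s ⊨ φ [ σ ])
  ⊨-[] 𝓜 σ (var r) s = mk⇔ id id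
  ⊨-[] 𝓜 σ (~ φ) s = mk⇔ (_∘′ from (⊨-[] 𝓜 σ φ s)) (_∘′ to (⊨-[] 𝓜 σ φ s))
  ⊨-[] 𝓜 σ (φ ∧ ψ) s = mk⇔
    (λ { (x , y) → to (⊨-[] 𝓜 σ φ s) x , to (⊨-[] 𝓜 σ ψ s) y })
    (λ { (x , y) → from (⊨-[] 𝓜 σ φ s) x , from (⊨-[] 𝓜 σ ψ s) y })
  ⊨-[] 𝓜 σ (∘ φ) s = mk⇔
    (λ h x t sRt → to (⊨-[] 𝓜 σ φ t) (h (from (⊨-[] 𝓜 σ φ s) x) t sRt))
    (λ h x t sRt → from (⊨-[] 𝓜 σ φ t) (h (to (⊨-[] 𝓜 σ φ s) x) t sRt))

  module _ (p q : P) (F : FrameClass) where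

    open K∘ p q

    axiom-valid : Axiom φ → ValidOn F φ
    axiom-valid (taut {φ} t) 𝓜 _ s      = ⊨-tautology {φ = φ} 𝓜 s t
    axiom-valid ∘⊤ 𝓜 _ s _ t _ (x , ¬x) = ¬x x
    axiom-valid ¬p⇒∘ 𝓜 _ s (¬x , ¬∘)    = ¬∘ (λ x → contradiction x ¬x)
    axiom-valid ∘∧ 𝓜 _ s ((∘x , ∘y) , ¬∘) =
      ¬∘ λ { (x , y) t sRt → ∘x x t sRt , ∘y y t sRt }

    substitution-valid : ∀ (φ : Formula P) σ → ValidOn F φ → ValidOn F (φ [ σ ])
    substitution-valid φ σ h 𝓜 f s = to (⊨-[] 𝓜 σ φ s) (h (substituted 𝓜 σ) f s)

    -- The invariant is validity on the class, not truth at one state: substitution changes the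
    -- model, and the `∘`-rule uses its premise at successors.
    step-valid : ∀ {prior} → All (ValidOn F) prior → Step ∅ prior φ → ValidOn F φ
    step-valid hs (axiom {α} a σ)        = substitution-valid α σ (axiom-valid a)
    step-valid hs (substitution {φ} i σ) = substitution-valid φ σ (All.lookup hs i)
    step-valid hs (modusPonens {φ} {ψ} i j) 𝓜 f s =
      ⊨-⇒ 𝓜 φ ψ (All.lookup hs j 𝓜 f s) (All.lookup hs i 𝓜 f s)
    step-valid hs (∘-rule {φ} {ψ} i) 𝓜 f s ((∘x , x) , ¬∘) =
      ¬∘ λ _ t sRt → ⊨-⇒ 𝓜 φ ψ (All.lookup hs i 𝓜 f t) (∘x x t sRt)

    derivation-valid : ∀ {φs} → Derivation ∅ φs → All (ValidOn F) φs
    derivation-valid []      = []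
    derivation-valid (x ∷ d) = step-valid (derivation-valid d) x ∷ derivation-valid d

    sound : Sound p q F
    sound φ (_ , d) = All.head (derivation-valid d)

theorem35 : ExcludedMiddle 0ℓ →
    (P : Set) (p q : P) → p ≢ q →
    Sound p q Serial × StronglyComplete p q Serial
theorem35 em P p q p≢q = Soundness.sound em p q Serial , stronglyComplete em p q p≢q
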